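{- For every positive integer $n$, the number of quasi-Stirling permutations $\pi$ of size $n$ with $\operatorname{des}(\pi)=n$ is $(n+1)^{n-1}$.
   Context: For a sequence $\pi=\pi_1\cdots\pi_r$ of positive integers, $i\in\{1,\dots,r\}$ is a descent if $\pi_i>\pi_{i+1}$ or $i=r$ (so the last position always counts as a descent), and $\operatorname{des}(\pi)$ is the number of descents. A quasi-Stirling permutation of size $n$ is a permutation $\pi_1\cdots\pi_{2n}$ of the multiset $\{1,1,2,2,\dots,n,n\}$ for which there are no indices $i<j<k<\ell$ with $\pi_i=\pi_k$ and $\pi_j=\pi_\ell$ (i.e. it avoids the patterns $1212$ and $2121$). -}

module Defs where

open import Data.Nat using (ℕ; zero; suc; _+_; _*_; _<ᵇ_; _≡ᵇ_; _^_; _∸_)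
open import Data.Bool using (Bool; true; false; _∧_; _∨_; not; if_then_else_)
open import Data.List using (List; []; _∷_; map; concatMap; filter; length; upTo)
open import Relation.Nullary.Decidable using (Dec)
open import Data.Bool.Properties using (T?)
open import Data.Bool using (T)

words : ℕ → ℕ → List (List ℕ)
words n zero = [] ∷ []
words n (suc r) = concatMap (λ a → map (a ∷_) (words n r)) (map suc (upTo n))

allB : {A : Set} → (A → Bool) → List A → Bool
allB p [] = true
allB p (x ∷ xs) = p x ∧ allB p xs

occ : ℕ → List ℕ → ℕ
occ a [] = 0
occ a (x ∷ xs) = if a ≡ᵇ x then suc (occ a xs) else occ a xs

-- the list is a permutation of the multiset {1,1,2,2,...,n,n}
-- (given that all entries lie in {1..n}, this means each of 1..n occurs exactly twice
--  and the length is 2n)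
isMultisetPerm : ℕ → List ℕ → Bool
isMultisetPerm n w = (length w ≡ᵇ (2 * n)) ∧ allB (λ a → occ a w ≡ᵇ 2) (map suc (upTo n))

-- Pattern containment: exists i<j<k<l with π_i = π_k, π_j = π_l and π_i ≠ π_j
-- (π_i ≠ π_j, i.e. the pattern 1212 or 2121; the case π_i = π_j would be a
--  value occurring four times, impossible in a multiset permutation anyway,
--  but we exclude it explicitly to match "1212 or 2121").
-- We search by subsequences: match a pattern of "variables" x y x y.

has1 : ℕ → List ℕ → Bool
has1 y [] = false
has1 y (z ∷ zs) = (y ≡ᵇ z) ∨ has1 y zs

has2 : ℕ → ℕ → List ℕ → Bool
has2 x y [] = false
has2 x y (z ∷ zs) = ((x ≡ᵇ z) ∧ has1 y zs) ∨ has2 x y zs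

has3 : ℕ → List ℕ → Bool
has3 x [] = false
has3 x (z ∷ zs) = (not (x ≡ᵇ z) ∧ has2 x z zs) ∨ has3 x zs

hasXYXY : List ℕ → Bool
hasXYXY [] = false
hasXYXY (z ∷ zs) = has3 z zs ∨ hasXYXY zs

-- descents: i is a descent if π_i > π_{i+1}, or i is the last position
des : List ℕ → ℕ
des [] = 0
des (x ∷ []) = 1
des (x ∷ y ∷ ys) = (if y <ᵇ x then 1 else 0) + des (y ∷ ys)

isQuasiStirling : ℕ → List ℕ → Bool
isQuasiStirling n w = isMultisetPerm n w ∧ not (hasXYXY w)

qsWithDes : ℕ → ℕ → ℕ
qsWithDes n d = length (filter (λ w → T? (isQuasiStirling n w ∧ (des w ≡ᵇ d))) (words n (2 * n)))

{-# OPTIONS --safe #-}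
-- Read a quasi-Stirling permutation from left to right, keeping a stack of the
-- letters that have occurred once: each new letter either closes the top of the
-- stack or is unused so far and is pushed. The letters pushed directly on top of
-- p are the children of p in a rooted tree with root 0, and p followed by its
-- children is read as a cyclic sequence having at most as many cyclic descents as
-- there are children. Hence des π ≤ n, with equality iff every such cyclic sequence
-- is decreasing, so the maximal permutations correspond to unordered labelled
-- trees on {0,…,n}.
--
-- They are counted by tracking the number of completions of a prefix. If m letters
-- are unused and x_s is m plus the number of levels of the stack that may still
-- receive the unused letter s as a child, this number is
--   F(x) = ∏ x_s − ∑_t ∏_{s≠t} x_s,
-- the determinant of diag(x) − J (matrix-tree theorem). F is affine in every
-- variable with F(x + e_a) = F(x) + F_{without a}(x), and summing this over the
-- letters a the top level may receive, in the order in which it may receive them,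
-- gives exactly the recursion on the next letter. At the start all x_s = n + 1 and
-- F = (n+1)^(n-1).
module Submission where

open import Defs
open import Data.Nat using (ℕ; zero; suc; _+_; _*_; _^_; _∸_; _≤_; _<_; _<ᵇ_; _≡ᵇ_; z≤n; s≤s)
open import Data.Nat.Properties
open import Data.Nat.Solver using (module +-*-Solver)
open import Data.Integer using (ℤ; +_; 0ℤ; 1ℤ; _-_) renaming (_+_ to _⊞_; _*_ to _⊠_)
import Data.Integer.Properties as ℤ
open import Data.Integer.Tactic.RingSolver using (solve-∀)
open import Algebra.Properties.CommutativeSemigroup +-commutativeSemigroup using (x∙yz≈y∙xz)
open import Data.Bool using (Bool; true; false; _∧_; _∨_; not; if_then_else_; T)
open import Data.Bool.Properties using (T?; ∨-identityʳ; ∧-zeroʳ; ∧-identityʳ; ∨-conicalˡ; ∨-conicalʳ; not-injective)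
open import Data.List using (List; []; _∷_; _++_; length; map; concatMap; filter; upTo; applyUpTo)
open import Data.List.Properties using (filter-++; length-++; map-upTo)
open import Data.List.Membership.Propositional using (_∈_)
open import Data.List.Relation.Unary.Any using (here; there)
open import Data.List.Relation.Unary.All as All using (All; []; _∷_)
open import Data.List.Relation.Unary.AllPairs as AllPairs using (AllPairs; []; _∷_)
open import Data.List.Relation.Unary.Unique.Propositional using (Unique)
open import Data.Empty using (⊥-elim)
open import Data.Product using (_×_; _,_; proj₁; proj₂)
open import Data.Sum using (_⊎_; inj₁; inj₂)
open import Data.Unit using (tt)
open import Function using (_∘_; case_of_)
open import Relation.Nullary using (yes; no)
open import Relation.Binary.PropositionalEquality

-- Boolean comparisons and deletion of a letter from a set.

ι : Bool → ℕ
ι b = if b then 1 else 0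

<ᵇ-true : ∀ {m n} → m < n → (m <ᵇ n) ≡ true
<ᵇ-true {m} {n} p with m <ᵇ n | <⇒<ᵇ p
... | true | _ = refl

<ᵇ-true⁻¹ : ∀ m n → (m <ᵇ n) ≡ true → m < n
<ᵇ-true⁻¹ m n e = <ᵇ⇒< m n (subst T (sym e) tt)

<ᵇ-false : ∀ {m n} → n ≤ m → (m <ᵇ n) ≡ false
<ᵇ-false {m} {n} p with m <ᵇ n in e
... | true  = ⊥-elim (<⇒≱ (<ᵇ-true⁻¹ m n e) p)
... | false = refl

<ᵇ-false⁻¹ : ∀ m n → (m <ᵇ n) ≡ false → n ≤ m
<ᵇ-false⁻¹ m n e = ≮⇒≥ λ p → case trans (sym e) (<ᵇ-true p) of λ ()

≡ᵇ-refl : ∀ a → (a ≡ᵇ a) ≡ true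
≡ᵇ-refl zero = refl
≡ᵇ-refl (suc a) = ≡ᵇ-refl a

≡ᵇ-true⁻¹ : ∀ a b → (a ≡ᵇ b) ≡ true → a ≡ b
≡ᵇ-true⁻¹ a b e = ≡ᵇ⇒≡ a b (subst T (sym e) tt)

≡ᵇ-false : ∀ {a b} → a ≢ b → (a ≡ᵇ b) ≡ false
≡ᵇ-false {a} {b} a≢b with a ≡ᵇ b in e
... | true  = ⊥-elim (a≢b (≡ᵇ-true⁻¹ a b e))
... | false = refl

infixl 7 _∖_
_∖_ : (ℕ → Bool) → ℕ → ℕ → Bool
(σ ∖ a) s = σ s ∧ not (s ≡ᵇ a)

∖-at : ∀ σ a → (σ ∖ a) a ≡ false
∖-at σ a rewrite ≡ᵇ-refl a = ∧-zeroʳ (σ a)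

∖-off : ∀ σ {a s} → s ≢ a → (σ ∖ a) s ≡ σ s
∖-off σ {a} {s} s≢a rewrite ≡ᵇ-false s≢a = ∧-identityʳ (σ s)

∖-⊆ : ∀ σ {a s} → (σ ∖ a) s ≡ true → σ s ≡ true × s ≢ a
∖-⊆ σ {a} {s} e with σ s | s ≡ᵇ a in eq
... | true | false = refl , λ { refl → case trans (sym (≡ᵇ-refl a)) eq of λ () }

-- The determinant of diag(x) - J on a selected set of letters.

size : (ℕ → Bool) → List ℕ → ℕ
size σ [] = 0
size σ (a ∷ L) = ι (σ a) + size σ L

-- Products over the letters of L selected by σ; forests is det(diag(x) − J), expanded along L.
prod : (ℕ → Bool) → (ℕ → ℕ) → List ℕ → ℤ
prod σ x [] = 1ℤ
prod σ x (a ∷ L) = if σ a then + x a ⊠ prod σ x L else prod σ x L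

forests : (ℕ → Bool) → (ℕ → ℕ) → List ℕ → ℤ
forests σ x [] = 1ℤ
forests σ x (a ∷ L) = if σ a then + x a ⊠ forests σ x L - prod σ x L else forests σ x L

module _ {σ τ : ℕ → Bool} where

  size-cong : ∀ L → (∀ {s} → s ∈ L → σ s ≡ τ s) → size σ L ≡ size τ L
  size-cong [] e = refl
  size-cong (a ∷ L) e = cong₂ (λ b k → ι b + k) (e (here refl)) (size-cong L (e ∘ there))

  module _ {x y : ℕ → ℕ} where

    prod-cong : ∀ L → (∀ {s} → s ∈ L → σ s ≡ τ s) →
                (∀ {s} → s ∈ L → σ s ≡ true → x s ≡ y s) → prod σ x L ≡ prod τ y L
    prod-cong [] e f = refl
    prod-cong (a ∷ L) e f rewrite sym (e (here refl)) with σ a in eq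
    ... | true  = cong₂ (λ u v → + u ⊠ v) (f (here refl) eq) (prod-cong L (e ∘ there) (f ∘ there))
    ... | false = prod-cong L (e ∘ there) (f ∘ there)

    forests-cong : ∀ L → (∀ {s} → s ∈ L → σ s ≡ τ s) →
                   (∀ {s} → s ∈ L → σ s ≡ true → x s ≡ y s) → forests σ x L ≡ forests τ y L
    forests-cong [] e f = refl
    forests-cong (a ∷ L) e f rewrite sym (e (here refl)) with σ a in eq
    ... | true  = cong₂ _-_
                    (cong₂ (λ u v → + u ⊠ v) (f (here refl) eq) (forests-cong L (e ∘ there) (f ∘ there)))
                    (prod-cong L (e ∘ there) (f ∘ there))
    ... | false = forests-cong L (e ∘ there) (f ∘ there)

tail-≢ : ∀ {a b : ℕ} {L} → All (a ≢_) L → b ∈ L → b ≢ a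
tail-≢ a∉L b∈L refl = All.lookup a∉L b∈L refl

size-delete : ∀ σ {a L} → Unique L → a ∈ L → σ a ≡ true → size σ L ≡ suc (size (σ ∖ a) L)
size-delete σ {a} {_ ∷ L} (a∉L ∷ u) (here refl) σa rewrite σa | ≡ᵇ-refl a =
  cong suc (size-cong L λ s∈L → sym (∖-off σ (tail-≢ a∉L s∈L)))
size-delete σ {a} {b ∷ L} (b∉L ∷ u) (there a∈L) σa
  rewrite ∖-off σ {a} {b} (tail-≢ b∉L a∈L ∘ sym) | size-delete σ u a∈L σa = +-suc (ι (σ b)) _

size-zero : ∀ {σ L a} → size σ L ≡ 0 → a ∈ L → σ a ≡ false
size-zero {σ} {b ∷ L} e (here refl) with σ b
... | false = refl
size-zero {σ} {b ∷ L} e (there a∈L) = size-zero {σ} {L} (m+n≡0⇒n≡0 (ι (σ b)) e) a∈L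

zero-size : ∀ {σ} L → (∀ {a} → a ∈ L → σ a ≡ false) → size σ L ≡ 0
zero-size [] f = refl
zero-size (a ∷ L) f rewrite f (here refl) = zero-size L (f ∘ there)

forests-empty : ∀ {σ x} L → size σ L ≡ 0 → forests σ x L ≡ 1ℤ
forests-empty [] e = refl
forests-empty {σ} (a ∷ L) e with σ a
... | false = forests-empty L e

module _ (c : ℕ) where

  prod-const : ∀ σ L → prod σ (λ _ → c) L ≡ + (c ^ size σ L)
  prod-const σ [] = refl
  prod-const σ (a ∷ L) with σ a
  ... | true  = trans (cong (+ c ⊠_) (prod-const σ L)) (sym (ℤ.pos-* c _))
  ... | false = prod-const σ L

  -- On k selected letters the matrix cI - J has eigenvalue c with multiplicity k - 1 and c - k
  -- once. The extra factor c on the left avoids the exponent k - 1.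
  forests-const : ∀ σ L → + c ⊠ forests σ (λ _ → c) L ≡ (+ c - + size σ L) ⊠ prod σ (λ _ → c) L
  forests-const σ [] = eq (+ c)
    where
    eq : ∀ c → c ⊠ 1ℤ ≡ (c - 0ℤ) ⊠ 1ℤ
    eq = solve-∀
  forests-const σ (a ∷ L) with σ a
  ... | false = forests-const σ L
  ... | true = trans (eq₁ (+ c) _ _) (trans (cong (λ z → + c ⊠ z - + c ⊠ prod σ (λ _ → c) L) (forests-const σ L))
                 (trans (eq₂ (+ c) (+ size σ L) (prod σ (λ _ → c) L)) (cong (λ z → (+ c - z) ⊠ (+ c ⊠ prod σ (λ _ → c) L)) (sym (ℤ.pos-+ 1 (size σ L))))))
    where
    eq₁ : ∀ c f p → c ⊠ (c ⊠ f - p) ≡ c ⊠ (c ⊠ f) - c ⊠ p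
    eq₁ = solve-∀
    eq₂ : ∀ c s p → c ⊠ ((c - s) ⊠ p) - c ⊠ p ≡ (c - (1ℤ ⊞ s)) ⊠ (c ⊠ p)
    eq₂ = solve-∀

-- With the stack empty no level can receive the remaining letters.
forests-unrooted : ∀ σ L {m} → size σ L ≡ suc m → forests σ (λ _ → size σ L) L ≡ 0ℤ
forests-unrooted σ L {m} e rewrite e = ℤ.*-cancelˡ-≡ (+ suc m) _ 0ℤ (begin
  + suc m ⊠ forests σ (λ _ → suc m) L               ≡⟨ forests-const (suc m) σ L ⟩
  (+ suc m - + size σ L) ⊠ prod σ (λ _ → suc m) L   ≡⟨ cong (λ k → (+ suc m - + k) ⊠ prod σ (λ _ → suc m) L) e ⟩
  (+ suc m - + suc m) ⊠ prod σ (λ _ → suc m) L      ≡⟨ cong (_⊠ prod σ (λ _ → suc m) L) (ℤ.+-inverseʳ (+ suc m)) ⟩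
  0ℤ                                                 ≡⟨ sym (ℤ.*-zeroʳ (+ suc m)) ⟩
  + suc m ⊠ 0ℤ                                      ∎)
  where open ≡-Reasoning

-- For k selected letters and c = k + 1 the factor c - k in `forests-const` is 1, which leaves
-- Cayley's number of trees on k + 1 vertices.
forests-rooted : ∀ σ L {m} → size σ L ≡ suc m → forests σ (λ _ → suc (size σ L)) L ≡ + (suc (suc m) ^ m)
forests-rooted σ L {m} e rewrite e = ℤ.*-cancelˡ-≡ (+ c) _ _ (begin
  + c ⊠ forests σ (λ _ → c) L               ≡⟨ forests-const c σ L ⟩
  (+ c - + size σ L) ⊠ prod σ (λ _ → c) L   ≡⟨ cong₂ _⊠_ (cong (λ k → + c - + k) e) (trans (prod-const c σ L) (cong (λ k → + (c ^ k)) e)) ⟩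
  (+ c - + suc m) ⊠ + (c ^ suc m)           ≡⟨ cong (λ z → (z - + suc m) ⊠ + (c ^ suc m)) (ℤ.pos-+ 1 (suc m)) ⟩
  (1ℤ ⊞ + suc m - + suc m) ⊠ + (c ^ suc m)  ≡⟨ eq (+ suc m) (+ (c ^ suc m)) ⟩
  + (c ^ suc m)                             ≡⟨ ℤ.pos-* c (c ^ m) ⟩
  + c ⊠ + (c ^ m)                           ∎)
  where
  open ≡-Reasoning
  c : ℕ
  c = suc (suc m)
  eq : ∀ m p → (1ℤ ⊞ m - m) ⊠ p ≡ p
  eq = solve-∀

module _ (σ : ℕ → Bool) {x x′ : ℕ → ℕ} {a : ℕ} (σa : σ a ≡ true)
         (at : x′ a ≡ suc (x a)) (off : ∀ {s} → s ≢ a → x′ s ≡ x s) where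

  prod-bump : ∀ {L} → Unique L → a ∈ L → prod σ x′ L ≡ prod σ x L ⊞ prod (σ ∖ a) x L
  prod-bump {_ ∷ L} (a∉L ∷ u) (here refl)
    rewrite σa | ≡ᵇ-refl a | at
          | prod-cong {σ} {σ} {x′} {x} L (λ _ → refl) (λ s∈L _ → off (tail-≢ a∉L s∈L))
          | prod-cong {σ ∖ a} {σ} {x} {x} L (∖-off σ ∘ tail-≢ a∉L) (λ _ _ → refl)
          | ℤ.pos-+ 1 (x a) = eq (+ x a) (prod σ x L)
    where
    eq : ∀ x p → (1ℤ ⊞ x) ⊠ p ≡ x ⊠ p ⊞ p
    eq = solve-∀
  prod-bump {b ∷ L} (b∉L ∷ u) (there a∈L)
    rewrite ∖-off σ {a} {b} (tail-≢ b∉L a∈L ∘ sym) with σ b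
  ... | false = prod-bump u a∈L
  ... | true rewrite off (tail-≢ b∉L a∈L ∘ sym) | prod-bump u a∈L =
    ℤ.*-distribˡ-+ (+ x b) _ _

  -- At `a` itself the subtracted product runs over later letters only, so it does not see the
  -- change. At a letter before `a` that product changes too, which is why `prod-bump` is needed.
  forests-bump : ∀ {L} → Unique L → a ∈ L → forests σ x′ L ≡ forests σ x L ⊞ forests (σ ∖ a) x L
  forests-bump {_ ∷ L} (a∉L ∷ u) (here refl)
    rewrite σa | ≡ᵇ-refl a | at
          | prod-cong {σ} {σ} {x′} {x} L (λ _ → refl) (λ s∈L _ → off (tail-≢ a∉L s∈L))
          | forests-cong {σ} {σ} {x′} {x} L (λ _ → refl) (λ s∈L _ → off (tail-≢ a∉L s∈L))
          | forests-cong {σ ∖ a} {σ} {x} {x} L (∖-off σ ∘ tail-≢ a∉L) (λ _ _ → refl)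
          | ℤ.pos-+ 1 (x a) = eq (+ x a) (forests σ x L) (prod σ x L)
    where
    eq : ∀ x f p → (1ℤ ⊞ x) ⊠ f - p ≡ x ⊠ f - p ⊞ f
    eq = solve-∀
  forests-bump {b ∷ L} (b∉L ∷ u) (there a∈L)
    rewrite ∖-off σ {a} {b} (tail-≢ b∉L a∈L ∘ sym) with σ b
  ... | false = forests-bump u a∈L
  ... | true rewrite off (tail-≢ b∉L a∈L ∘ sym) | prod-bump u a∈L | forests-bump u a∈L =
    eq (+ x b) (forests σ x L) (forests (σ ∖ a) x L) (prod σ x L) (prod (σ ∖ a) x L)
    where
    eq : ∀ x f g p q → x ⊠ (f ⊞ g) - (p ⊞ q) ≡ x ⊠ f - p ⊞ (x ⊠ g - q)
    eq = solve-∀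

-- Finite sums, ranges and telescoping.

∑ : List ℕ → (ℕ → ℤ) → ℤ
∑ [] f = 0ℤ
∑ (a ∷ L) f = f a ⊞ ∑ L f

∑-cong : ∀ {f g} L → (∀ {a} → a ∈ L → f a ≡ g a) → ∑ L f ≡ ∑ L g
∑-cong [] e = refl
∑-cong (a ∷ L) e = cong₂ _⊞_ (e (here refl)) (∑-cong L (e ∘ there))

∑-+ : ∀ f g L → ∑ L (λ a → f a ⊞ g a) ≡ ∑ L f ⊞ ∑ L g
∑-+ f g [] = refl
∑-+ f g (a ∷ L) rewrite ∑-+ f g L = eq (f a) (g a) (∑ L f) (∑ L g)
  where
  eq : ∀ a b c d → a ⊞ b ⊞ (c ⊞ d) ≡ a ⊞ c ⊞ (b ⊞ d)
  eq = solve-∀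

∑-zero : ∀ L → ∑ L (λ _ → 0ℤ) ≡ 0ℤ
∑-zero [] = refl
∑-zero (a ∷ L) = trans (ℤ.+-identityˡ _) (∑-zero L)

∑-exchange : ∀ {f g p L} → Unique L → p ∈ L → (∀ {a} → a ∈ L → a ≢ p → g a ≡ f a) → f p ≡ 0ℤ →
             ∑ L g ≡ g p ⊞ ∑ L f
∑-exchange {f} {g} {p} {_ ∷ L} (p∉L ∷ u) (here refl) e fp
  rewrite fp | ∑-cong {g} {f} L (λ a∈L → e (there a∈L) (tail-≢ p∉L a∈L)) =
  cong (g p ⊞_) (sym (ℤ.+-identityˡ _))
∑-exchange {f} {g} {p} {b ∷ L} (b∉L ∷ u) (there p∈L) e fp
  rewrite e (here refl) (tail-≢ b∉L p∈L ∘ sym) | ∑-exchange {f} {g} u p∈L (e ∘ there) fp =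
  eq (f b) (g p) (∑ L f)
  where
  eq : ∀ a b c → a ⊞ (b ⊞ c) ≡ b ⊞ (a ⊞ c)
  eq = solve-∀

range : ℕ → ℕ → List ℕ
range b zero = []
range b (suc k) = b ∷ range (suc b) k

range-≥ : ∀ {a} b k → a ∈ range b k → b ≤ a
range-≥ b (suc k) (here refl) = ≤-refl
range-≥ b (suc k) (there i) = ≤-trans (n≤1+n b) (range-≥ (suc b) k i)

range-< : ∀ {a} b k → a ∈ range b k → a < b + k
range-< b (suc k) (here refl) = m<m+n b (s≤s z≤n)
range-< {a} b (suc k) (there i) = subst (a <_) (sym (+-suc b k)) (range-< (suc b) k i)

range-unique : ∀ b k → Unique (range b k)
range-unique b zero = []
range-unique b (suc k) =
  All.tabulate (λ i e → <⇒≢ (range-≥ (suc b) k i) e) ∷ range-unique (suc b) k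

telescope : ∀ {t K : ℕ → ℤ} b k → (∀ {a} → a ∈ range b k → K (suc a) ≡ K a ⊞ t a) →
            K (b + k) ≡ K b ⊞ ∑ (range b k) t
telescope {t} {K} b zero e = trans (cong K (+-identityʳ b)) (sym (ℤ.+-identityʳ (K b)))
telescope {t} {K} b (suc k) e
  rewrite +-suc b k | telescope {t} {K} (suc b) k (e ∘ there) | e (here refl) = ℤ.+-assoc (K b) _ _

-- Raising weights one letter at a time, and cyclic intervals.

infixl 6 _⊕_
_⊕_ : (ℕ → ℕ) → (ℕ → Bool) → ℕ → ℕ
(y ⊕ c) s = y s + ι (c s)

forests-⊕-cong : ∀ {τ c d} y L → (∀ {s} → s ∈ L → τ s ≡ true → c s ≡ d s) →
                 forests τ (y ⊕ c) L ≡ forests τ (y ⊕ d) L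
forests-⊕-cong y L e = forests-cong L (λ _ → refl) (λ {s} s∈L τs → cong (λ b → y s + ι b) (e s∈L τs))

module _ (n : ℕ) (σ : ℕ → Bool) (y : ℕ → ℕ) where

  private
    L : List ℕ
    L = range 1 n

  module _ (v B : ℕ → Bool) where

    -- The set that grows from v to v ∪ B by adding the elements of B in increasing order.
    below : ℕ → ℕ → Bool
    below a s = v s ∨ (B s ∧ (s <ᵇ a))

    chain-term : ℕ → ℤ
    chain-term a = if σ a ∧ B a then forests (σ ∖ a) (y ⊕ below a) L else 0ℤ

    below-suc-off : ∀ {a s} → s ≢ a → below (suc a) s ≡ below a s
    below-suc-off {a} {s} s≢a with s <ᵇ a in e
    ... | true rewrite <ᵇ-true (m<n⇒m<1+n (<ᵇ-true⁻¹ s a e)) = refl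
    ... | false rewrite <ᵇ-false (≤∧≢⇒< (<ᵇ-false⁻¹ s a e) (s≢a ∘ sym)) = refl

    below-suc-∉ : ∀ {a s} → (s ≡ a → B s ≡ false) → below (suc a) s ≡ below a s
    below-suc-∉ {a} {s} Ba with s ≟ a
    ... | no s≢a = below-suc-off s≢a
    ... | yes s≡a rewrite Ba s≡a = refl

    -- Only the weight of `a` can change. If `a` is selected and lies in `B`, disjointness from `v`
    -- makes the rise exactly one and `forests-bump` applies; if `a` is not selected, its weight is
    -- never read.
    chain-step : (∀ {s} → B s ≡ true → v s ≡ false) → ∀ {a} → a ∈ L →
      forests σ (y ⊕ below (suc a)) L ≡ forests σ (y ⊕ below a) L ⊞ chain-term a
    chain-step B∩v {a} a∈L with σ a in σa | B a in Ba
    ... | true | true = forests-bump σ σa at off (range-unique 1 n) a∈L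
      where
      at : (y ⊕ below (suc a)) a ≡ suc ((y ⊕ below a) a)
      at rewrite Ba | B∩v Ba | <ᵇ-true (n<1+n a) | <ᵇ-false (≤-refl {a}) = +-suc (y a) 0
      off : ∀ {s} → s ≢ a → (y ⊕ below (suc a)) s ≡ (y ⊕ below a) s
      off {s} s≢a = cong (λ b → y s + ι b) (below-suc-off s≢a)
    ... | true | false = trans (forests-⊕-cong y L λ _ _ → below-suc-∉ λ { refl → Ba }) (sym (ℤ.+-identityʳ _))
    ... | false | _ = trans (forests-⊕-cong y L λ _ σs → below-suc-off λ { refl → case trans (sym σs) σa of λ () })
                            (sym (ℤ.+-identityʳ _))

    chain : (∀ {s} → B s ≡ true → v s ≡ false) →
            forests σ (y ⊕ (λ s → v s ∨ B s)) L ≡ forests σ (y ⊕ v) L ⊞ ∑ L chain-term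
    chain B∩v = begin
      forests σ (y ⊕ (λ s → v s ∨ B s)) L          ≡⟨ forests-⊕-cong y L (λ {s} s∈L _ → top s∈L) ⟩
      forests σ (y ⊕ below (1 + n)) L              ≡⟨ telescope {chain-term} {λ a → forests σ (y ⊕ below a) L} 1 n (chain-step B∩v) ⟩
      forests σ (y ⊕ below 1) L ⊞ ∑ L chain-term   ≡⟨ cong (_⊞ ∑ L chain-term) (forests-⊕-cong y L (λ {s} s∈L _ → bot s∈L)) ⟩
      forests σ (y ⊕ v) L ⊞ ∑ L chain-term         ∎
      where
      open ≡-Reasoning
      top : ∀ {s} → s ∈ L → v s ∨ B s ≡ below (1 + n) s
      top {s} s∈L rewrite <ᵇ-true (range-< 1 n s∈L) | ∧-identityʳ (B s) = refl
      bot : ∀ {s} → s ∈ L → below 1 s ≡ v s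
      bot {s} s∈L rewrite <ᵇ-false (range-≥ 1 n s∈L) | ∧-zeroʳ (B s) = ∨-identityʳ (v s)

-- a lies strictly between l and p when descending cyclically from l to p
-- (from p all the way round to p if l = p).
allowed : ℕ → ℕ → ℕ → Bool
allowed p l a = if p <ᵇ l then (p <ᵇ a) ∧ (a <ᵇ l) else (p <ᵇ a) ∨ (a <ᵇ l)

allowed-self : ∀ p l → allowed p l p ≡ false
allowed-self p l with p <ᵇ l
... | true rewrite <ᵇ-false (≤-refl {p}) = refl
... | false rewrite <ᵇ-false (≤-refl {p}) = refl

-- A level without children has its own label as last letter, so the whole circle is still open to
-- it.
allowed-fresh : ∀ {a s} → s ≢ a → allowed a a s ≡ true
allowed-fresh {a} {s} s≢a rewrite <ᵇ-false (≤-refl {a}) with a <ᵇ s in e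
... | true = refl
... | false = <ᵇ-true (≤∧≢⇒< (<ᵇ-false⁻¹ a s e) s≢a)

module _ (n : ℕ) (σ : ℕ → Bool) (y : ℕ → ℕ) where

  private
    L : List ℕ
    L = range 1 n

  push-term : ℕ → ℕ → ℕ → ℤ
  push-term p l a = if σ a ∧ allowed p l a then forests (σ ∖ a) (y ⊕ allowed p a) L else 0ℤ

  -- The weights of the letters in `allowed p l` are raised in cyclically increasing order, starting
  -- just after `p`. When `a` has its turn, the letters already raised are exactly those of
  -- `allowed p a`, which are the ones the level may still receive after `a`.
  forests-allowed : ∀ p l → forests σ (y ⊕ allowed p l) L ≡ forests σ y L ⊞ ∑ L (push-term p l)
  forests-allowed p l with p <ᵇ l in p<l
  ... | true = trans (chain n σ y v B (λ _ → refl))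
                 (cong₂ _⊞_ (forests-cong L (λ _ → refl) (λ {s} _ _ → +-identityʳ (y s)))
                            (∑-cong L (λ {a} _ → term a)))
    where
    v B : ℕ → Bool
    v _ = false
    B s = (p <ᵇ s) ∧ (s <ᵇ l)
    term : ∀ a → chain-term n σ y v B a ≡ (if σ a ∧ B a then forests (σ ∖ a) (y ⊕ allowed p a) L else 0ℤ)
    term a with σ a | p <ᵇ a in p<a | a <ᵇ l in a<l
    ... | false | _ | _ = refl
    ... | true | false | _ = refl
    ... | true | true | false = refl
    ... | true | true | true = forests-⊕-cong y L (λ {s} _ _ → same s)
      where
      same : ∀ s → B s ∧ (s <ᵇ a) ≡ (p <ᵇ s) ∧ (s <ᵇ a)
      same s with p <ᵇ s | s <ᵇ a in s<a
      ... | false | _ = refl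
      ... | true | false = ∧-zeroʳ _
      ... | true | true rewrite <ᵇ-true (<-trans (<ᵇ-true⁻¹ s a s<a) (<ᵇ-true⁻¹ a l a<l)) = refl
  -- The interval wraps around: the letters above `p` come first, then those below `l`, so two
  -- chains are concatenated.
  ... | false = begin
      forests σ (y ⊕ (λ s → A s ∨ B s)) L
        ≡⟨ chain n σ y A B disjoint ⟩
      forests σ (y ⊕ A) L ⊞ ∑ L tB
        ≡⟨ cong (_⊞ ∑ L tB) (chain n σ y (λ _ → false) A (λ _ → refl)) ⟩
      forests σ (y ⊕ (λ _ → false)) L ⊞ ∑ L tA ⊞ ∑ L tB
        ≡⟨ ℤ.+-assoc (forests σ (y ⊕ (λ _ → false)) L) (∑ L tA) (∑ L tB) ⟩
      forests σ (y ⊕ (λ _ → false)) L ⊞ (∑ L tA ⊞ ∑ L tB)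
        ≡⟨ cong₂ _⊞_ (forests-cong L (λ _ → refl) (λ {s} _ _ → +-identityʳ (y s)))
                     (trans (sym (∑-+ tA tB L)) (∑-cong L (λ {a} _ → term a))) ⟩
      forests σ y L ⊞ ∑ L (λ a → if σ a ∧ (A a ∨ B a) then forests (σ ∖ a) (y ⊕ allowed p a) L else 0ℤ)
        ∎
    where
    open ≡-Reasoning
    l≤p : l ≤ p
    l≤p = <ᵇ-false⁻¹ p l p<l
    A B : ℕ → Bool
    A s = p <ᵇ s
    B s = s <ᵇ l
    disjoint : ∀ {s} → B s ≡ true → A s ≡ false
    disjoint {s} s<l = <ᵇ-false (≤-trans (<⇒≤ (<ᵇ-true⁻¹ s l s<l)) l≤p)
    tA tB : ℕ → ℤ
    tA = chain-term n σ y (λ _ → false) A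
    tB = chain-term n σ y A B
    term : ∀ a → tA a ⊞ tB a ≡ (if σ a ∧ (A a ∨ B a) then forests (σ ∖ a) (y ⊕ allowed p a) L else 0ℤ)
    term a with σ a | p <ᵇ a in p<a | a <ᵇ l in a<l
    ... | false | _ | _ = refl
    ... | true | false | false = refl
    ... | true | true | true = case trans (sym p<a) (disjoint a<l) of λ ()
    ... | true | true | false = ℤ.+-identityʳ _
    ... | true | false | true =
      trans (ℤ.+-identityˡ _) (forests-⊕-cong y L (λ {s} _ _ → same s))
      where
      same : ∀ s → A s ∨ (B s ∧ (s <ᵇ a)) ≡ (p <ᵇ s) ∨ (s <ᵇ a)
      same s with s <ᵇ a in s<a
      ... | false = cong (A s ∨_) (∧-zeroʳ (B s))
      ... | true rewrite <ᵇ-true (<-trans (<ᵇ-true⁻¹ s a s<a) (<ᵇ-true⁻¹ a l a<l)) = refl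

-- The stack automaton and the number of words it accepts.

top : List ℕ → ℕ
-- The root is the parent of every letter pushed on the empty stack.
top [] = 0
top (p ∷ _) = p

-- σ: unused letters; l: last letter read; ps: letters read once, latest first. The last
-- child of each level below the top is the letter stacked on it, so only l is recorded.
module _ (ok : ℕ → ℕ → ℕ → Bool) (L : List ℕ) where

  accept : (ℕ → Bool) → ℕ → List ℕ → List ℕ → Bool
  push : (ℕ → Bool) → ℕ → List ℕ → ℕ → List ℕ → Bool

  accept σ l [] [] = size σ L ≡ᵇ 0
  accept σ l (p ∷ ps) [] = false
  accept σ l [] (a ∷ w) = push σ l [] a w
  accept σ l (p ∷ ps) (a ∷ w) = if a ≡ᵇ p then accept σ p ps w else push σ l (p ∷ ps) a w

  push σ l ps a w = σ a ∧ (ok (top ps) l a ∧ accept (σ ∖ a) a (a ∷ ps) w)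

-- Valued in the integers because it is compared with determinants, which involve subtraction.
count : List ℕ → ℕ → (List ℕ → Bool) → ℤ
count L zero f = + ι (f [])
count L (suc r) f = ∑ L λ a → count L r (f ∘ (a ∷_))

count-false : ∀ L r → count L r (λ _ → false) ≡ 0ℤ
count-false L zero = refl
count-false L (suc r) = trans (∑-cong L (λ _ → count-false L r)) (∑-zero L)

-- m plus the number of levels of the stack (for under: excluding the top level) allowing s.
weight : ℕ → ℕ → List ℕ → ℕ → ℕ
under : ℕ → List ℕ → ℕ → ℕ

weight m l ps = under m ps ⊕ allowed (top ps) l

under m [] _ = m
under m (p ∷ ps) = weight m p ps

under-suc : ∀ m ps s → under (suc m) ps s ≡ suc (under m ps s)
under-suc m [] s = refl
under-suc m (p ∷ ps) s = cong (_+ ι (allowed (top ps) p s)) (under-suc m ps s)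

module _ (n : ℕ) where

  private
    L : List ℕ
    L = range 1 n

  weight-push : ∀ {σ a m} ps → forests (σ ∖ a) (weight m a (a ∷ ps)) L
                             ≡ forests (σ ∖ a) (weight (suc m) a ps) L
  weight-push {σ} {a} {m} ps = forests-cong L (λ _ → refl) λ {s} _ σs → same s (proj₂ (∖-⊆ σ σs))
    where
    same : ∀ s → s ≢ a → weight m a (a ∷ ps) s ≡ weight (suc m) a ps s
    same s s≢a rewrite allowed-fresh s≢a | under-suc m ps s = +-comm _ 1

  count-accept : ∀ r σ l ps → All (_∈ L) ps → r ≡ size σ L + size σ L + length ps →
                 count L r (accept allowed L σ l ps) ≡ forests σ (weight (size σ L) l ps) L

  count-push : ∀ r σ l ps → All (_∈ L) ps → suc r ≡ size σ L + size σ L + length ps →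
               ∀ {a} → a ∈ L → count L r (push allowed L σ l ps a)
                             ≡ push-term n σ (under (size σ L) ps) (top ps) l a

  count-push r σ l ps ps⊆L e {a} a∈L with σ a in σa | allowed (top ps) l a
  ... | false | _ = count-false L r
  ... | true | false = count-false L r
  ... | true | true rewrite size-delete σ (range-unique 1 n) a∈L σa =
    trans (count-accept r (σ ∖ a) a (a ∷ ps) (a∈L ∷ ps⊆L) r≡) (weight-push {σ} ps)
    where
    k = size (σ ∖ a) L
    r≡ : r ≡ k + k + suc (length ps)
    r≡ = suc-injective (trans e (cong suc (trans (cong (_+ length ps) (+-suc k k)) (sym (+-suc (k + k) (length ps))))))

  count-accept zero σ l [] _ e with size σ L in m≡
  ... | zero = sym (forests-empty L m≡)
  count-accept zero σ l (p ∷ ps) _ e = case trans e (+-suc _ (length ps)) of λ ()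
  count-accept (suc r) σ l [] _ e = begin
    ∑ L (λ a → count L r (push allowed L σ l [] a))
      ≡⟨ ∑-cong L (count-push r σ l [] [] e) ⟩
    ∑ L (push-term n σ (under m []) 0 l)
      ≡⟨ sym (ℤ.+-identityˡ _) ⟩
    0ℤ ⊞ ∑ L (push-term n σ (under m []) 0 l)
      ≡⟨ cong (_⊞ ∑ L (push-term n σ (under m []) 0 l)) (sym (unrooted m refl e)) ⟩
    forests σ (under m []) L ⊞ ∑ L (push-term n σ (under m []) 0 l)
      ≡⟨ sym (forests-allowed n σ (under m []) 0 l) ⟩
    forests σ (weight m l []) L ∎
    where
    open ≡-Reasoning
    m = size σ L
    unrooted : ∀ k → m ≡ k → suc r ≡ m + m + 0 → forests σ (under m []) L ≡ 0ℤ
    unrooted zero m≡ e rewrite m≡ = case e of λ ()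
    unrooted (suc k) m≡ e = forests-unrooted σ L m≡
  count-accept (suc r) σ l (p ∷ ps) (p∈L ∷ ps⊆L) e = begin
    ∑ L (λ a → count L r (accept allowed L σ l (p ∷ ps) ∘ (a ∷_)))
      ≡⟨ ∑-exchange (range-unique 1 n) p∈L other at-p ⟩
    count L r (accept allowed L σ l (p ∷ ps) ∘ (p ∷_)) ⊞ ∑ L t
      ≡⟨ cong (_⊞ ∑ L t) pop ⟩
    forests σ (under m (p ∷ ps)) L ⊞ ∑ L t
      ≡⟨ sym (forests-allowed n σ (under m (p ∷ ps)) p l) ⟩
    forests σ (weight m l (p ∷ ps)) L ∎
    where
    open ≡-Reasoning
    m = size σ L
    t : ℕ → ℤ
    t = push-term n σ (under m (p ∷ ps)) p l
    -- Reading `p` always closes it, and `p` is never allowed below itself. The sum over pushes is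
    -- therefore zero at `p`, and the closing term is simply added to it.
    at-p : t p ≡ 0ℤ
    at-p rewrite allowed-self p l | ∧-zeroʳ (σ p) = refl
    other : ∀ {a} → a ∈ L → a ≢ p → count L r (accept allowed L σ l (p ∷ ps) ∘ (a ∷_)) ≡ t a
    other a∈L a≢p rewrite ≡ᵇ-false a≢p = count-push r σ l (p ∷ ps) (p∈L ∷ ps⊆L) e a∈L
    pop : count L r (accept allowed L σ l (p ∷ ps) ∘ (p ∷_)) ≡ forests σ (under m (p ∷ ps)) L
    pop rewrite ≡ᵇ-refl p = count-accept r σ p ps ps⊆L (suc-injective (trans e (+-suc _ _)))

-- Descents and the potential that bounds them.

∧-true : ∀ {b c} → b ∧ c ≡ true → b ≡ true × c ≡ true
∧-true {true} {true} _ = refl , refl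

⇔→≡ : ∀ {b c} → (b ≡ true → c ≡ true) → (c ≡ true → b ≡ true) → b ≡ c
⇔→≡ {true} f g = sym (f refl)
⇔→≡ {false} {true} f g = g refl
⇔→≡ {false} {false} f g = refl

-- The number of levels, including the root 0, whose last child exceeds their label. With m
-- unused letters, m + drops l ps bounds the descents to come: closing a letter preserves
-- the slack, and pushing a preserves it iff a is allowed.
drops : ℕ → List ℕ → ℕ
drops-below : List ℕ → ℕ
drops l ps = ι (top ps <ᵇ l) + drops-below ps
drops-below [] = 0
drops-below (p ∷ ps) = drops p ps

-- A virtual final 0 accounts for the last position being a descent.
des-from : ℕ → List ℕ → ℕ
des-from l [] = ι (0 <ᵇ l)
des-from l (x ∷ w) = ι (x <ᵇ l) + des-from x w

des-from-∷ : ∀ x w → All (0 <_) (x ∷ w) → des-from x w ≡ des (x ∷ w)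
des-from-∷ x [] (0<x ∷ _) rewrite <ᵇ-true 0<x = refl
des-from-∷ x (y ∷ w) (_ ∷ pos) = cong (λ z → ι (y <ᵇ x) + z) (des-from-∷ y w pos)

des-from-zero : ∀ w → All (0 <_) w → des-from 0 w ≡ des w
des-from-zero [] _ = refl
des-from-zero (x ∷ w) pos = des-from-∷ x w pos

-- Compares the route from the last child `l` to `a` and back to the parent `p` with the direct step
-- from `l` to `p`: a detour along the descending arc gains exactly one descent.
allowed-drop : ∀ p l a → allowed p l a ≡ true → ι (a <ᵇ l) + ι (p <ᵇ a) ≡ 1 + ι (p <ᵇ l)
allowed-drop p l a ok with p <ᵇ l in p<l | p <ᵇ a in p<a | a <ᵇ l in a<l
... | true  | true  | true  = refl
... | false | true  | false = refl
... | false | false | true  = refl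
... | false | true  | true  =
  ⊥-elim (<⇒≱ (<-trans (<ᵇ-true⁻¹ p a p<a) (<ᵇ-true⁻¹ a l a<l)) (<ᵇ-false⁻¹ p l p<l))

forbidden-drop : ∀ p l a → allowed p l a ≡ false → ι (a <ᵇ l) + ι (p <ᵇ a) < 1 + ι (p <ᵇ l)
forbidden-drop p l a ok with p <ᵇ l | p <ᵇ a | a <ᵇ l
... | true  | true  | false = ≤-refl
... | true  | false | true  = ≤-refl
... | true  | false | false = s≤s z≤n
... | false | false | false = ≤-refl

-- With this in place of `allowed`, `accept` recognises all quasi-Stirling permutations, whatever
-- their descents.
anything : ℕ → ℕ → ℕ → Bool
anything _ _ _ = true

Dichotomy : Bool → ℕ → ℕ → Set
Dichotomy b d m = (b ≡ true × d ≡ m) ⊎ (b ≡ false × d < m)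

module _ {L : List ℕ} where

  accept-anything : ∀ w σ l ps → accept allowed L σ l ps w ≡ true → accept anything L σ l ps w ≡ true
  push-anything : ∀ a w σ l ps → push allowed L σ l ps a w ≡ true → push anything L σ l ps a w ≡ true

  accept-anything [] σ l [] e = e
  accept-anything (a ∷ w) σ l [] e = push-anything a w σ l [] e
  accept-anything (a ∷ w) σ l (p ∷ ps) e with a ≡ᵇ p
  ... | true  = accept-anything w σ p ps e
  ... | false = push-anything a w σ l (p ∷ ps) e

  push-anything a w σ l ps e with σ a | allowed (top ps) l a
  ... | true | true = accept-anything w (σ ∖ a) a (a ∷ ps) e

module _ {L : List ℕ} (unique : Unique L) where

  -- The potential is `size σ L + drops l ps`. Closing `p` moves the summand `ι (p <ᵇ l)` from the
  -- potential to the descents read; a push is settled by `allowed-drop` or `forbidden-drop`.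
  des-accept : ∀ w σ l ps → All (_∈ L) w → accept anything L σ l ps w ≡ true →
               Dichotomy (accept allowed L σ l ps w) (des-from l w) (size σ L + drops l ps)
  des-push : ∀ a w σ l ps → a ∈ L → All (_∈ L) w → push anything L σ l ps a w ≡ true →
             Dichotomy (push allowed L σ l ps a w) (des-from l (a ∷ w)) (size σ L + drops l ps)

  des-accept [] σ l [] _ e = inj₁ (e , sym (trans (cong (_+ (ι (0 <ᵇ l) + 0)) (≡ᵇ-true⁻¹ (size σ L) 0 e)) (+-identityʳ _)))
  des-accept (a ∷ w) σ l [] (a∈L ∷ w⊆L) e = des-push a w σ l [] a∈L w⊆L e
  des-accept (a ∷ w) σ l (p ∷ ps) (a∈L ∷ w⊆L) e with a ≡ᵇ p in a≡p
  ... | false = des-push a w σ l (p ∷ ps) a∈L w⊆L e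
  ... | true rewrite ≡ᵇ-true⁻¹ a p a≡p with des-accept w σ p ps w⊆L e
  ... | inj₁ (q , d≡) = inj₁ (q , trans (cong (λ d → ι (p <ᵇ l) + d) d≡) (x∙yz≈y∙xz (ι (p <ᵇ l)) (size σ L) (drops p ps)))
  ... | inj₂ (q , d<) = inj₂ (q , <-≤-trans (+-monoʳ-< (ι (p <ᵇ l)) d<)
                                            (≤-reflexive (x∙yz≈y∙xz (ι (p <ᵇ l)) (size σ L) (drops p ps))))

  des-push a w σ l ps a∈L w⊆L e with σ a in σa
  ... | true rewrite size-delete σ unique a∈L σa
      with des-accept w (σ ∖ a) a (a ∷ ps) w⊆L e | allowed (top ps) l a in ok
  ... | ih | okay = go ih okay ok
    where
    open ≤-Reasoning
    k u v r : ℕ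
    k = size (σ ∖ a) L
    u = ι (a <ᵇ l)
    v = ι (top ps <ᵇ a)
    r = drops-below ps
    -- The new level has no child yet, and `a` does not exceed itself.
    before : k + drops a (a ∷ ps) ≡ k + (v + r)
    before rewrite <ᵇ-false (≤-refl {a}) = refl
    left : u + (k + drops a (a ∷ ps)) ≡ (u + v) + (k + r)
    left = trans (cong (λ z → u + z) before)
      (solve 4 (λ u v k r → u :+ (k :+ (v :+ r)) := (u :+ v) :+ (k :+ r)) refl u v k r)
      where open +-*-Solver
    right : (1 + ι (top ps <ᵇ l)) + (k + r) ≡ suc k + drops l ps
    right = solve 3 (λ i k r → (con 1 :+ i) :+ (k :+ r) := (con 1 :+ k) :+ (i :+ r)) refl (ι (top ps <ᵇ l)) k r
      where open +-*-Solver
    go : ∀ {b d} → Dichotomy b d (k + drops a (a ∷ ps)) → ∀ okay → allowed (top ps) l a ≡ okay →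
         Dichotomy (okay ∧ b) (u + d) (suc k + drops l ps)
    go (inj₁ (refl , refl)) true ok = inj₁ (refl ,
      trans left (trans (cong (_+ (k + r)) (allowed-drop (top ps) l a ok)) right))
    go {d = d} (inj₂ (refl , d<)) true ok = inj₂ (refl , (begin-strict
      u + d                                <⟨ +-monoʳ-< u d< ⟩
      u + (k + drops a (a ∷ ps))           ≡⟨ left ⟩
      (u + v) + (k + r)                    ≡⟨ cong (_+ (k + r)) (allowed-drop (top ps) l a ok) ⟩
      (1 + ι (top ps <ᵇ l)) + (k + r)      ≡⟨ right ⟩
      suc k + drops l ps                   ∎))
    -- After a forbidden push the bound is already strict, so only the weak inequality is taken from
    -- the induction hypothesis.
    go {d = d} dich false ok = inj₂ (refl , (begin-strict
      u + d                                ≤⟨ +-monoʳ-≤ u (bound dich) ⟩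
      u + (k + drops a (a ∷ ps))           ≡⟨ left ⟩
      (u + v) + (k + r)                    <⟨ +-monoˡ-< (k + r) (forbidden-drop (top ps) l a ok) ⟩
      (1 + ι (top ps <ᵇ l)) + (k + r)      ≡⟨ right ⟩
      suc k + drops l ps                   ∎))
      where
      bound : ∀ {b d m} → Dichotomy b d m → d ≤ m
      bound (inj₁ (_ , refl)) = ≤-refl
      bound (inj₂ (_ , d<)) = <⇒≤ d<

  accept-allowed : ∀ w σ l ps → All (_∈ L) w →
    accept allowed L σ l ps w ≡ accept anything L σ l ps w ∧ (des-from l w ≡ᵇ size σ L + drops l ps)
  accept-allowed w σ l ps w⊆L with accept anything L σ l ps w in e
  ... | false = ⇔→≡ (λ q → trans (sym e) (accept-anything w σ l ps q)) (λ ())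
  ... | true with des-accept w σ l ps w⊆L e
  ... | inj₁ (q , d≡) rewrite q | d≡ = sym (≡ᵇ-refl (size σ L + drops l ps))
  ... | inj₂ (q , d<) rewrite q = sym (≡ᵇ-false (<⇒≢ d<))

-- Stack acceptance and pattern avoidance.

occ-at : ∀ a w → occ a (a ∷ w) ≡ suc (occ a w)
occ-at a w rewrite ≡ᵇ-refl a = refl

occ-off : ∀ {a x} w → a ≢ x → occ a (x ∷ w) ≡ occ a w
occ-off w a≢x rewrite ≡ᵇ-false a≢x = refl

occ⇒∈ : ∀ {a} w {k} → occ a w ≡ suc k → a ∈ w
occ⇒∈ {a} (x ∷ w) e with a ≡ᵇ x in a≡x
... | true  = here (≡ᵇ-true⁻¹ a x a≡x)
... | false = there (occ⇒∈ w e)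

occ⇒≢ : ∀ {a} w → occ a w ≡ 0 → All (_≢ a) w
occ⇒≢ [] e = []
occ⇒≢ {a} (x ∷ w) e with a ≡ᵇ x in a≡x
... | false = (λ { refl → case trans (sym (≡ᵇ-refl a)) a≡x of λ () }) ∷ occ⇒≢ w e

occ⇒has1 : ∀ {a} w → occ a w ≡ 0 → has1 a w ≡ false
occ⇒has1 [] e = refl
occ⇒has1 {a} (x ∷ w) e with a ≡ᵇ x
... | false = occ⇒has1 w e

has1⇒occ : ∀ {a} w → has1 a w ≡ false → occ a w ≡ 0
has1⇒occ [] e = refl
has1⇒occ {a} (x ∷ w) e with a ≡ᵇ x
... | false = has1⇒occ w e

has2-∉ˡ : ∀ {x y} w → has1 x w ≡ false → has2 x y w ≡ false
has2-∉ˡ [] e = refl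
has2-∉ˡ {x} (z ∷ w) e with x ≡ᵇ z
... | false = has2-∉ˡ w e

has2-∉ʳ : ∀ {x y} w → has1 y w ≡ false → has2 x y w ≡ false
has2-∉ʳ [] e = refl
has2-∉ʳ {x} {y} (z ∷ w) e
  rewrite ∨-conicalʳ (y ≡ᵇ z) (has1 y w) e | ∧-zeroʳ (x ≡ᵇ z) = has2-∉ʳ w (∨-conicalʳ (y ≡ᵇ z) _ e)

has3-∉ : ∀ {x} w → has1 x w ≡ false → has3 x w ≡ false
has3-∉ [] e = refl
has3-∉ {x} (z ∷ w) e
  rewrite has2-∉ˡ {x} {z} w (∨-conicalʳ (x ≡ᵇ z) _ e) | ∧-zeroʳ (not (x ≡ᵇ z)) =
  has3-∉ w (∨-conicalʳ (x ≡ᵇ z) _ e)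

-- The stack lists later letters first, so `p` was opened before `q` and a further p, q would
-- complete p q p q. A new first letter could matter only as that `p`, which the first hypothesis
-- excludes.
nested-∷ : ∀ {a qs} w → All (_≢ a) qs → AllPairs (λ q p → has2 p q w ≡ false) qs →
           AllPairs (λ q p → has2 p q (a ∷ w) ≡ false) qs
nested-∷ w [] [] = []
nested-∷ {a} w (_ ∷ qs≢a) (e ∷ es) = All.zipWith skip (qs≢a , e) ∷ nested-∷ w qs≢a es
  where
  skip : ∀ {p q} → p ≢ a × has2 p q w ≡ false → has2 p q (a ∷ w) ≡ false
  skip (p≢a , f) rewrite ≡ᵇ-false p≢a = f

Exclusive : (ℕ → Bool) → List ℕ → Set
Exclusive σ ps = ∀ a → ι (σ a) + occ a ps ≤ 1

exclusive-push : ∀ σ ps {a} → Exclusive σ ps → σ a ≡ true → Exclusive (σ ∖ a) (a ∷ ps)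
exclusive-push σ ps {a} ex σa b with b ≟ a
... | no b≢a rewrite ∖-off σ b≢a | ≡ᵇ-false b≢a = ex b
... | yes refl with ex a
... | h rewrite ∖-at σ a | ≡ᵇ-refl a | σa = h

exclusive-pop : ∀ σ p ps → Exclusive σ (p ∷ ps) → Exclusive σ ps
exclusive-pop σ p ps ex b = ≤-trans (+-monoʳ-≤ (ι (σ b)) (drop (b ≡ᵇ p))) (ex b)
  where
  drop : ∀ c → occ b ps ≤ (if c then suc (occ b ps) else occ b ps)
  drop true = n≤1+n _
  drop false = ≤-refl

exclusive-unused : ∀ σ ps {a} → Exclusive σ ps → σ a ≡ true → occ a ps ≡ 0
exclusive-unused σ ps {a} ex σa with ex a
... | h rewrite σa with h
... | s≤s z = n≤0⇒n≡0 z

exclusive-top : ∀ σ p ps → Exclusive σ (p ∷ ps) → σ p ≡ false × occ p ps ≡ 0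
exclusive-top σ p ps ex with ex p
... | h rewrite ≡ᵇ-refl p with σ p | h
... | false | s≤s z = refl , n≤0⇒n≡0 z
... | true | s≤s ()

-- What remains to be required of the suffix w once the prefix has been read.
record Residual (L : List ℕ) (σ : ℕ → Bool) (ps w : List ℕ) : Set where
  field
    occurrences : ∀ {a} → a ∈ L → occ a w ≡ 2 * ι (σ a) + occ a ps
    no-xyxy : hasXYXY w ≡ false
    no-yxy : All (λ p → has3 p w ≡ false) ps
    nested : AllPairs (λ q p → has2 p q w ≡ false) ps

open Residual

module _ {L : List ℕ} {σ : ℕ → Bool} where

  pop-complete : ∀ {p ps w} → Residual L σ (p ∷ ps) (p ∷ w) → Residual L σ ps w
  pop-complete {p} {ps} {w} R = record
    { occurrences = occs
    ; no-xyxy = ∨-conicalʳ (has3 p w) _ (no-xyxy R)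
    ; no-yxy = All.map (∨-conicalʳ _ _) (All.tail (no-yxy R))
    ; nested = AllPairs.map (∨-conicalʳ _ _) (AllPairs.tail (nested R))
    }
    where
    occs : ∀ {a} → a ∈ L → occ a w ≡ 2 * ι (σ a) + occ a ps
    occs {a} a∈L with a ≡ᵇ p | occurrences R a∈L
    ... | false | e = e
    ... | true  | e = suc-injective (trans e (+-suc (2 * ι (σ a)) (occ a ps)))

  -- Exclusiveness leaves no occurrence of `p` due after this one, so `p` is absent from `w` and
  -- cannot take part in a new pattern.
  pop-sound : ∀ {p ps w} → p ∈ L → Exclusive σ (p ∷ ps) → Residual L σ ps w → Residual L σ (p ∷ ps) (p ∷ w)
  pop-sound {p} {ps} {w} p∈L ex R = record
    { occurrences = occs
    ; no-xyxy = trans (cong (_∨ hasXYXY w) has3p) (no-xyxy R)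
    ; no-yxy = at-p ∷ All.zipWith (λ {q} → other {q}) (p∉ps , no-yxy R)
    ; nested = All.map (λ {q} → pair-p {q}) p∉ps ∷ nested-∷ w p∉ps (nested R)
    }
    where
    p∉ps : All (_≢ p) ps
    p∉ps = occ⇒≢ ps (proj₂ (exclusive-top σ p ps ex))
    p∉w : has1 p w ≡ false
    p∉w = occ⇒has1 w (trans (occurrences R p∈L)
      (cong₂ (λ b k → 2 * ι b + k) (proj₁ (exclusive-top σ p ps ex)) (proj₂ (exclusive-top σ p ps ex))))
    has3p : has3 p w ≡ false
    has3p = has3-∉ w p∉w
    occs : ∀ {a} → a ∈ L → occ a (p ∷ w) ≡ 2 * ι (σ a) + occ a (p ∷ ps)
    occs {a} a∈L with a ≡ᵇ p
    ... | false = occurrences R a∈L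
    ... | true  = trans (cong suc (occurrences R a∈L)) (sym (+-suc (2 * ι (σ a)) (occ a ps)))
    at-p : has3 p (p ∷ w) ≡ false
    at-p rewrite ≡ᵇ-refl p = has3p
    other : ∀ {q} → q ≢ p × has3 q w ≡ false → has3 q (p ∷ w) ≡ false
    other {q} (_ , e) rewrite has2-∉ʳ {q} {p} w p∉w | ∧-zeroʳ (not (q ≡ᵇ p)) = e
    pair-p : ∀ {q} → q ≢ p → has2 q p (p ∷ w) ≡ false
    pair-p q≢p rewrite ≡ᵇ-false q≢p = has2-∉ʳ w p∉w

  -- Each condition loses the first letter of its pattern: `no-xyxy` yields `no-yxy` for `a`, and
  -- `no-yxy` for an open `p` yields `nested` for the pair of `a` and `p`.
  push-complete : ∀ {a ps w} → a ∈ L → Exclusive σ ps → σ a ≡ true →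
                  Residual L σ ps (a ∷ w) → Residual L (σ ∖ a) (a ∷ ps) w
  push-complete {a} {ps} {w} a∈L ex σa R = record
    { occurrences = occs
    ; no-xyxy = ∨-conicalʳ (has3 a w) _ (no-xyxy R)
    ; no-yxy = ∨-conicalˡ (has3 a w) _ (no-xyxy R) ∷ All.map (∨-conicalʳ _ _) (no-yxy R)
    ; nested = All.zipWith (λ {p} → pair {p}) (a∉ps , no-yxy R) ∷ AllPairs.map (∨-conicalʳ _ _) (nested R)
    }
    where
    a∉ps : All (_≢ a) ps
    a∉ps = occ⇒≢ ps (exclusive-unused σ ps ex σa)
    occs : ∀ {b} → b ∈ L → occ b w ≡ 2 * ι ((σ ∖ a) b) + occ b (a ∷ ps)
    occs {b} b∈L with b ≟ a
    ... | no b≢a rewrite ∖-off σ b≢a | occ-off ps b≢a = trans (sym (occ-off w b≢a)) (occurrences R b∈L)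
    ... | yes refl with occurrences R a∈L
    ... | e rewrite σa | ≡ᵇ-refl a = suc-injective e
    pair : ∀ {p} → p ≢ a × has3 p (a ∷ w) ≡ false → has2 p a w ≡ false
    pair {p} (p≢a , e) rewrite ≡ᵇ-false p≢a = ∨-conicalˡ (has2 p a w) _ e

  push-sound : ∀ {a ps w} → a ∈ L → Exclusive σ ps → σ a ≡ true →
               Residual L (σ ∖ a) (a ∷ ps) w → Residual L σ ps (a ∷ w)
  push-sound {a} {ps} {w} a∈L ex σa R = record
    { occurrences = occs
    ; no-xyxy = trans (cong (_∨ hasXYXY w) (All.head (no-yxy R))) (no-xyxy R)
    ; no-yxy = All.zipWith (λ {p} → triple {p}) (AllPairs.head (nested R) , All.tail (no-yxy R))
    ; nested = nested-∷ w a∉ps (AllPairs.tail (nested R))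
    }
    where
    a∉ps : All (_≢ a) ps
    a∉ps = occ⇒≢ ps (exclusive-unused σ ps ex σa)
    occs : ∀ {b} → b ∈ L → occ b (a ∷ w) ≡ 2 * ι (σ b) + occ b ps
    occs {b} b∈L with b ≟ a | occurrences R b∈L
    ... | no b≢a | e rewrite ∖-off σ b≢a | occ-off ps b≢a | ≡ᵇ-false b≢a = e
    ... | yes refl | e rewrite ∖-at σ a | ≡ᵇ-refl a | σa = cong suc e
    triple : ∀ {p} → has2 p a w ≡ false × has3 p w ≡ false → has3 p (a ∷ w) ≡ false
    triple {p} (e , f) rewrite e | ∧-zeroʳ (not (p ≡ᵇ a)) = f

  opens : ∀ {a ps w} → a ∈ L → All (_∈ L) ps → a ≢ top ps → Residual L σ ps (a ∷ w) → σ a ≡ true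
  opens {a} {ps} {w} a∈L ps⊆L a≢top R with σ a | occurrences R a∈L
  ... | true | _ = refl
  opens {a} {[]} {w} a∈L ps⊆L a≢top R | false | e rewrite ≡ᵇ-refl a = case e of λ ()
  opens {a} {p ∷ ps} {w} a∈L (p∈L ∷ _) a≢p R | false | e
    rewrite ≡ᵇ-refl a | ≡ᵇ-false a≢p = case contra of λ ()
    where
    p-closed : has2 a p (a ∷ w) ≡ false
    p-closed = All.lookup (AllPairs.head (nested R)) (occ⇒∈ ps (sym e))
    p∉w : has1 p w ≡ false
    p∉w = ∨-conicalˡ _ (has2 a p w) (subst (λ b → (b ∧ has1 p w) ∨ has2 a p w ≡ false) (≡ᵇ-refl a) p-closed)
    contra : 0 ≡ suc (2 * ι (σ p) + occ p ps)
    contra = begin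
      0                                    ≡⟨ sym (has1⇒occ w p∉w) ⟩
      occ p w                              ≡⟨ sym (occ-off w (a≢p ∘ sym)) ⟩
      occ p (a ∷ w)                        ≡⟨ occurrences R p∈L ⟩
      2 * ι (σ p) + occ p (p ∷ ps)         ≡⟨ cong (λ z → 2 * ι (σ p) + z) (occ-at p ps) ⟩
      2 * ι (σ p) + suc (occ p ps)         ≡⟨ +-suc (2 * ι (σ p)) (occ p ps) ⟩
      suc (2 * ι (σ p) + occ p ps)         ∎
      where open ≡-Reasoning

module _ {L : List ℕ} (0∉L : All (0 <_) L) where

  private
    ≢0 : ∀ {a} → a ∈ L → a ≢ 0
    ≢0 a∈L refl = case All.lookup 0∉L a∈L of λ ()

  residual⇒accept : ∀ w {σ} l ps → All (_∈ L) w → All (_∈ L) ps → Exclusive σ ps →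
                    Residual L σ ps w → accept anything L σ l ps w ≡ true
  residual⇒accept [] {σ} l [] _ _ _ R = cong (_≡ᵇ 0) (zero-size {σ} L λ {a} a∈L → unused (σ a) (occurrences R a∈L))
    where
    unused : ∀ b → 0 ≡ 2 * ι b + 0 → b ≡ false
    unused false _ = refl
  residual⇒accept [] {σ} l (p ∷ ps) _ (p∈L ∷ _) _ R =
    case trans (occurrences R p∈L) (trans (cong (λ z → 2 * ι (σ p) + z) (occ-at p ps)) (+-suc _ _)) of λ ()
  -- On the empty stack `opens` compares `a` with the root 0, which is not a letter.
  residual⇒accept (a ∷ w) {σ} l [] (a∈L ∷ w⊆L) _ ex R with opens a∈L [] (≢0 a∈L) R
  ... | σa rewrite σa = residual⇒accept w a (a ∷ []) w⊆L (a∈L ∷ []) (exclusive-push σ [] ex σa) (push-complete a∈L ex σa R)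
  residual⇒accept (a ∷ w) {σ} l (p ∷ ps) (a∈L ∷ w⊆L) (p∈L ∷ ps⊆L) ex R with a ≡ᵇ p in a≡p
  ... | true rewrite ≡ᵇ-true⁻¹ a p a≡p =
    residual⇒accept w p ps w⊆L ps⊆L (exclusive-pop σ p ps ex) (pop-complete R)
  ... | false with opens a∈L (p∈L ∷ ps⊆L) (λ { refl → case trans (sym (≡ᵇ-refl a)) a≡p of λ () }) R
  ... | σa rewrite σa = residual⇒accept w a (a ∷ p ∷ ps) w⊆L (a∈L ∷ p∈L ∷ ps⊆L) (exclusive-push σ (p ∷ ps) ex σa)
                          (push-complete a∈L ex σa R)

module _ {L : List ℕ} where

  accept⇒residual : ∀ w {σ} l ps → All (_∈ L) w → Exclusive σ ps →
                    accept anything L σ l ps w ≡ true → Residual L σ ps w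
  push⇒residual : ∀ a w {σ} l ps → a ∈ L → All (_∈ L) w → Exclusive σ ps →
                  push anything L σ l ps a w ≡ true → Residual L σ ps (a ∷ w)

  accept⇒residual [] {σ} l [] _ _ e = record
    { occurrences = λ a∈L → sym (cong (λ b → 2 * ι b + 0) (size-zero {σ} (≡ᵇ-true⁻¹ (size σ L) 0 e) a∈L))
    ; no-xyxy = refl
    ; no-yxy = []
    ; nested = []
    }
  accept⇒residual (a ∷ w) l [] (a∈L ∷ w⊆L) ex e = push⇒residual a w l [] a∈L w⊆L ex e
  accept⇒residual (a ∷ w) {σ} l (p ∷ ps) (a∈L ∷ w⊆L) ex e with a ≡ᵇ p in a≡p
  ... | false = push⇒residual a w l (p ∷ ps) a∈L w⊆L ex e
  ... | true rewrite ≡ᵇ-true⁻¹ a p a≡p =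
    pop-sound a∈L ex (accept⇒residual w p ps w⊆L (exclusive-pop σ p ps ex) e)

  push⇒residual a w {σ} l ps a∈L w⊆L ex e with ∧-true {σ a} e
  ... | σa , e′ = push-sound a∈L ex σa (accept⇒residual w a (a ∷ ps) w⊆L (exclusive-push σ ps ex σa) e′)

-- From lists of words to the final count.

words-count : ∀ n r f → + length (filter (λ w → T? (f w)) (words n r)) ≡ count (map suc (upTo n)) r f
words-count n zero f with f []
... | true = refl
... | false = refl
words-count n (suc r) f = go (map suc (upTo n))
  where
  # : (List ℕ → Bool) → List (List ℕ) → ℕ
  # g ws = length (filter (λ w → T? (g w)) ws)
  #-map : ∀ a ws → # f (map (a ∷_) ws) ≡ # (f ∘ (a ∷_)) ws
  #-map a [] = refl
  #-map a (w ∷ ws) with f (a ∷ w)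
  ... | true = cong suc (#-map a ws)
  ... | false = #-map a ws
  go : ∀ L → + # f (concatMap (λ a → map (a ∷_) (words n r)) L)
           ≡ ∑ L (λ a → count (map suc (upTo n)) r (f ∘ (a ∷_)))
  go [] = refl
  go (a ∷ L) = begin
    + # f (ws ++ rest)                   ≡⟨ cong (λ v → + length v) (filter-++ (λ w → T? (f w)) ws rest) ⟩
    + length (filter (λ w → T? (f w)) ws ++ filter (λ w → T? (f w)) rest)
                                         ≡⟨ cong +_ (length-++ (filter (λ w → T? (f w)) ws)) ⟩
    + (# f ws + # f rest)                ≡⟨ ℤ.pos-+ (# f ws) (# f rest) ⟩
    + # f ws ⊞ + # f rest                ≡⟨ cong₂ _⊞_ (trans (cong +_ (#-map a (words n r))) (words-count n r (f ∘ (a ∷_)))) (go L) ⟩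
    ∑ (a ∷ L) (λ a → count (map suc (upTo n)) r (f ∘ (a ∷_))) ∎
    where
    open ≡-Reasoning
    ws rest : List (List ℕ)
    ws = map (a ∷_) (words n r)
    rest = concatMap (λ a → map (a ∷_) (words n r)) L

count-cong : ∀ {L f g} r → (∀ w → length w ≡ r → All (_∈ L) w → f w ≡ g w) → count L r f ≡ count L r g
count-cong zero e = cong (λ b → + ι b) (e [] refl [])
count-cong {L} (suc r) e =
  ∑-cong L λ {a} a∈L → count-cong r λ w len w⊆L → e (a ∷ w) (cong suc len) (a∈L ∷ w⊆L)

letters≡range : ∀ n → map suc (upTo n) ≡ range 1 n
letters≡range n = trans (map-upTo suc n) (go suc 1 n λ _ → refl)
  where
  go : ∀ f b k → (∀ i → f i ≡ b + i) → applyUpTo f k ≡ range b k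
  go f b zero e = refl
  go f b (suc k) e = cong₂ _∷_ (trans (e 0) (+-identityʳ b))
    (go (f ∘ suc) (suc b) k λ i → trans (e (suc i)) (+-suc b i))

allB-true : ∀ {p : ℕ → Bool} L → (∀ {a} → a ∈ L → p a ≡ true) → allB p L ≡ true
allB-true [] e = refl
allB-true (a ∷ L) e rewrite e (here refl) = allB-true L (e ∘ there)

allB-true⁻¹ : ∀ {p : ℕ → Bool} L → allB p L ≡ true → ∀ {a} → a ∈ L → p a ≡ true
allB-true⁻¹ {p} (b ∷ L) e (here refl) = proj₁ (∧-true {p b} e)
allB-true⁻¹ {p} (b ∷ L) e (there i) = allB-true⁻¹ L (proj₂ (∧-true {p b} e)) i

size-all : ∀ b k → size (λ _ → true) (range b k) ≡ k
size-all b zero = refl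
size-all b (suc k) = cong suc (size-all (suc b) k)

module _ (n : ℕ) where

  private
    L : List ℕ
    L = range 1 n
    all : ℕ → Bool
    all _ = true
    positive : All (0 <_) L
    positive = All.tabulate (range-≥ 1 n)
    exclusive : Exclusive all []
    exclusive _ = ≤-refl

  -- Before anything is read, `Residual` asks for two occurrences of every letter and no forbidden
  -- pattern; its stack conditions are empty.
  quasiStirling-accept : ∀ w → length w ≡ 2 * n → All (_∈ L) w →
                         isQuasiStirling n w ≡ accept anything L all 0 [] w
  quasiStirling-accept w len w⊆L
    rewrite len | ≡ᵇ-refl (2 * n) | letters≡range n = ⇔→≡ to from
    where
    to : allB (λ a → occ a w ≡ᵇ 2) L ∧ not (hasXYXY w) ≡ true → accept anything L all 0 [] w ≡ true
    to e with ∧-true {allB (λ a → occ a w ≡ᵇ 2) L} e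
    ... | twice , avoids = residual⇒accept positive w 0 [] w⊆L [] exclusive (record
      { occurrences = λ a∈L → ≡ᵇ-true⁻¹ _ 2 (allB-true⁻¹ L twice a∈L)
      ; no-xyxy = not-injective avoids
      ; no-yxy = []
      ; nested = []
      })
    from : accept anything L all 0 [] w ≡ true → allB (λ a → occ a w ≡ᵇ 2) L ∧ not (hasXYXY w) ≡ true
    from e = cong₂ _∧_ (allB-true L λ a∈L → cong (_≡ᵇ 2) (occurrences R a∈L)) (cong not (no-xyxy R))
      where
      R : Residual L all [] w
      R = accept⇒residual w 0 [] w⊆L exclusive e

  maximal-accept : ∀ w → length w ≡ 2 * n → All (_∈ L) w →
                   isQuasiStirling n w ∧ (des w ≡ᵇ n) ≡ accept allowed L all 0 [] w
  maximal-accept w len w⊆L = sym (trans (accept-allowed (range-unique 1 n) w all 0 [] w⊆L)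
    (cong₂ _∧_ (sym (quasiStirling-accept w len w⊆L))
       (cong₂ _≡ᵇ_ (des-from-zero w (All.map (range-≥ 1 n) w⊆L)) (trans (+-identityʳ _) (size-all 1 n)))))

theorem2p2 : (n : ℕ) → 1 ≤ n → qsWithDes n n ≡ (n + 1) ^ (n ∸ 1)
theorem2p2 n@(suc k) _ = ℤ.+-injective (begin
  + qsWithDes n n
    ≡⟨ words-count n (2 * n) (λ w → isQuasiStirling n w ∧ (des w ≡ᵇ n)) ⟩
  count (map suc (upTo n)) (2 * n) (λ w → isQuasiStirling n w ∧ (des w ≡ᵇ n))
    ≡⟨ cong (λ L → count L (2 * n) (λ w → isQuasiStirling n w ∧ (des w ≡ᵇ n))) (letters≡range n) ⟩
  count (range 1 n) (2 * n) (λ w → isQuasiStirling n w ∧ (des w ≡ᵇ n))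
    ≡⟨ count-cong (2 * n) (maximal-accept n) ⟩
  count (range 1 n) (2 * n) (accept allowed (range 1 n) all 0 [])
    ≡⟨ count-accept n (2 * n) all 0 [] [] lengths ⟩
  forests all (weight (size all (range 1 n)) 0 []) (range 1 n)
    ≡⟨ forests-cong {all} (range 1 n) (λ _ → refl) (λ s∈L _ → root s∈L) ⟩
  forests all (λ _ → suc (size all (range 1 n))) (range 1 n)
    ≡⟨ forests-rooted all (range 1 n) (size-all 1 n) ⟩
  + (suc n ^ k)
    ≡⟨ cong (λ m → + (m ^ k)) (+-comm 1 n) ⟩
  + ((n + 1) ^ k) ∎)
  where
  open ≡-Reasoning
  all : ℕ → Bool
  all _ = true
  lengths : 2 * n ≡ size all (range 1 n) + size all (range 1 n) + 0
  -- Since `n` is `suc k`, `range 1 n` has already unfolded to 1 followed by `range 2 k`.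
  lengths rewrite size-all 2 k = sym (+-assoc n n 0)
  -- The root has no child yet, so it allows every letter and adds one to each weight.
  root : ∀ {s} → s ∈ range 1 n → weight (size all (range 1 n)) 0 [] s ≡ suc (size all (range 1 n))
  root s∈L rewrite allowed-fresh {0} (λ e → <⇒≢ (range-≥ 1 n s∈L) (sym e)) = +-comm _ 1
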